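{- Let $r\ge 2$ be an integer that is the order of some finite projective plane. Then \[ \lim_{q\to\infty}\frac{\operatorname{achr}(K_{r^2+r+1}\,\square\, K_q)}{q}=\frac{r^2+r+1}{r+1}. \]
   Context: A vertex colouring $f:V(G)\to C$ of a finite simple graph $G$ with a finite colour set $C$ is complete if for any two distinct colours $c_1,c_2\in C$ there are adjacent vertices $v_1,v_2$ with $f(v_1)=c_1$, $f(v_2)=c_2$. The achromatic number $\operatorname{achr}(G)$ is the maximum number of colours in a proper complete vertex colouring of $G$. The Cartesian product $G_1\square G_2$ has vertex set $V(G_1)\times V(G_2)$, with $(x_1,y_1)$ adjacent to $(x_2,y_2)$ iff either $x_1=x_2$ and $y_1y_2\in E(G_2)$, or $x_1x_2\in E(G_1)$ and $y_1=y_2$. For $r\ge2$, a finite projective plane of order $r$ is a pair $(P,\mathcal L)$ of a finite set $P$ of points and a set $\mathcal L$ of subsets of $P$ (lines) such that any two distinct points lie in exactly one common line, any two distinct lines intersect, there are four points no three of which lie on a common line, and some line has exactly $r+1$ points; $r$ is a finite projective plane order if such a plane exists. -}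

module Defs where

open import Level using (0ℓ)
open import Data.Nat as ℕ using (ℕ; suc; _+_; _*_; _≤_; NonZero)
open import Data.Fin using (Fin)
open import Data.Fin.Subset using (Subset; _∈_; _∉_) renaming (∣_∣ to #_)
open import Data.Product using (Σ; ∃; _×_; _,_)
open import Data.Sum using (_⊎_)
open import Data.Integer using (+_)
open import Data.Rational using (ℚ; _/_; _-_; ∣_∣; _<_; 0ℚ)
open import Relation.Nullary using (¬_)
open import Relation.Binary.PropositionalEquality using (_≡_; _≢_)

record Graph : Set₁ where
  field
    size  : ℕ
    Adj   : Fin size → Fin size → Set
    sym   : ∀ {u v} → Adj u v → Adj v u
    irrefl : ∀ {u} → ¬ Adj u u
open Graph public

K : ℕ → Graph
K n = record { size = n ; Adj = λ u v → u ≢ v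
             ; sym = λ p e → p (Relation.Binary.PropositionalEquality.sym e)
             ; irrefl = λ p → p Relation.Binary.PropositionalEquality.refl }

open import Data.Fin using (remQuot)


_□_ : Graph → Graph → Graph
G₁ □ G₂ = record
  { size = size G₁ * size G₂
  ; Adj = λ a b → A (remQuot (size G₂) a) (remQuot (size G₂) b)
  ; sym = λ {a} {b} → symA (remQuot (size G₂) a) (remQuot (size G₂) b)
  ; irrefl = λ {a} → irrA (remQuot (size G₂) a)
  }
  where
  open import Relation.Binary.PropositionalEquality using (refl) renaming (sym to ≡sym)
  Pair = Fin (size G₁) × Fin (size G₂)
  A : Pair → Pair → Set
  A (x₁ , y₁) (x₂ , y₂) = (x₁ ≡ x₂ × Adj G₂ y₁ y₂) ⊎ (Adj G₁ x₁ x₂ × y₁ ≡ y₂)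
  symA : ∀ p q → A p q → A q p
  symA _ _ (Data.Sum.inj₁ (e , a)) = Data.Sum.inj₁ (≡sym e , Graph.sym G₂ a)
  symA _ _ (Data.Sum.inj₂ (a , e)) = Data.Sum.inj₂ (Graph.sym G₁ a , ≡sym e)
  irrA : ∀ p → ¬ A p p
  irrA _ (Data.Sum.inj₁ (_ , a)) = irrefl G₂ a
  irrA _ (Data.Sum.inj₂ (a , _)) = irrefl G₁ a

Proper : (G : Graph) {k : ℕ} → (Fin (size G) → Fin k) → Set
Proper G f = ∀ u v → Adj G u v → f u ≢ f v

Complete : (G : Graph) {k : ℕ} → (Fin (size G) → Fin k) → Set
Complete G {k} f = ∀ (c₁ c₂ : Fin k) → c₁ ≢ c₂ →
  Σ (Fin (size G)) λ v₁ → Σ (Fin (size G)) λ v₂ →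
    Adj G v₁ v₂ × f v₁ ≡ c₁ × f v₂ ≡ c₂

HasCompleteColouring : Graph → ℕ → Set
HasCompleteColouring G k =
  Σ (Fin (size G) → Fin k) λ f → Proper G f × Complete G f

IsAchr : Graph → ℕ → Set
IsAchr G a = HasCompleteColouring G a × (∀ k → HasCompleteColouring G k → k ≤ a)

-- Finite projective planes: points Fin m, lines an injective family
-- L : Fin l → Subset m (i.e. a set of l subsets of the points).

record ProjectivePlane (r : ℕ) : Set where
  field
    m l : ℕ
    L : Fin l → Subset m
    L-inj : ∀ i j → L i ≡ L j → i ≡ j
    two-points : ∀ (p q : Fin m) → p ≢ q →
      Σ (Fin l) λ i → (p ∈ L i × q ∈ L i) ×
        (∀ j → p ∈ L j → q ∈ L j → j ≡ i)
    two-lines : ∀ (i j : Fin l) → i ≢ j → Σ (Fin m) λ p → p ∈ L i × p ∈ L j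
    four-points : Σ (Fin m) λ p₁ → Σ (Fin m) λ p₂ → Σ (Fin m) λ p₃ → Σ (Fin m) λ p₄ →
      (p₁ ≢ p₂ × p₁ ≢ p₃ × p₁ ≢ p₄ × p₂ ≢ p₃ × p₂ ≢ p₄ × p₃ ≢ p₄) ×
      (∀ i → ¬ (p₁ ∈ L i × p₂ ∈ L i × p₃ ∈ L i)) ×
      (∀ i → ¬ (p₁ ∈ L i × p₂ ∈ L i × p₄ ∈ L i)) ×
      (∀ i → ¬ (p₁ ∈ L i × p₃ ∈ L i × p₄ ∈ L i)) ×
      (∀ i → ¬ (p₂ ∈ L i × p₃ ∈ L i × p₄ ∈ L i))
    line-size : Σ (Fin l) λ i → # (L i) ≡ suc r

Converges : (s : (q : ℕ) → .{{NonZero q}} → ℚ) → ℚ → Set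
Converges s L = ∀ (ε : ℚ) → 0ℚ < ε →
  Σ ℕ λ N → ∀ q .{{_ : NonZero q}} → N ≤ q → ∣ s q - L ∣ < ε

{-# OPTIONS --safe #-}
-- Let n = r² + r + 1, and colour the n × q grid K_n □ K_q.
--
-- Upper bound: if every colour occurs at least r + 1 times then there are at
-- most n q / (r + 1) colours.  Otherwise some colour occurs s ≤ r times, and
-- every other colour is seen in a row or a column of one of its occurrences, so
-- there are at most 1 + r (q + n) colours; this is smaller for large q since
-- r < n / (r + 1).
--
-- Lower bound: identify the rows with the points of the plane and write
-- q = (r + 1) t + d with d ≤ r.  Each of the n lines ℓ gets t colours (ℓ , j),
-- all of which appear in exactly the rows lying on ℓ; as any two lines meet, any
-- two colours appear together in some row.  Cutting the first (r + 1) t columns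
-- into r + 1 blocks of width t, the i-th cell of the e-th block of row x is
-- coloured (ℓ , x − i mod t), where ℓ is the e-th line through x.  A cell in one
-- of the last d columns receives its own index j, on a line missing its row.
module Submission where

open import Defs hiding (sym)
open import Data.Nat using (ℕ; zero; suc; _+_; _*_; _∸_; _≤_; _<_; s≤s; NonZero)
import Data.Nat as ℕ
open import Data.Nat.DivMod
  using (_%_; m≡m%n+[m/n]*n; m%n<n; m<n⇒m%n≡m; [m+n]%n≡m%n; %-distribˡ-+; m%n%n≡m%n; /-monoˡ-≤; m*n/n≡m)
import Data.Nat.Properties as ℕₚ
open import Data.Nat.Tactic.RingSolver using (solve-∀)
open import Data.Integer using (+_; +<+)
import Data.Integer as ℤ
import Data.Integer.Properties as ℤₚ
open import Data.Rational using (_/_)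
import Data.Rational as ℚ
import Data.Rational.Properties as ℚₚ
open import Data.Rational.Unnormalised using (ℚᵘ; mkℚᵘ; *<*) renaming (_-_ to _-ᵘ_; ∣_∣ to ∣_∣ᵘ; _≃_ to _≃ᵘ_)
import Data.Rational.Unnormalised.Properties as ℚᵘₚ
open import Data.Fin
  using (Fin; zero; suc; toℕ; fromℕ<; combine; remQuot; splitAt; inject≤; _↑ˡ_; punchIn; punchOut)
  renaming (join to joinFin)
open import Data.Fin.Properties
  using (_≟_; all?; ¬∀⟶∃¬; suc-injective; toℕ<n; toℕ-injective; toℕ-fromℕ<; injective⇒≤
        ; remQuot-combine; combine-remQuot; combine-injective; splitAt-↑ˡ
        ; join-splitAt; splitAt-join; inject≤-injective
        ; punchIn-injective; punchInᵢ≢i; punchIn-punchOut)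
open import Data.Fin.Subset using (Subset; _∈_; inside; outside) renaming (∣_∣ to #_)
open import Data.Fin.Subset.Properties using (_∈?_; drop-there)
open import Data.Vec.Base using ([]; _∷_; here; there)
open import Data.Product using (∃; ∃₂; _×_; _,_; proj₁; proj₂; uncurry)
open import Data.Sum using (_⊎_; inj₁; inj₂)
open import Function using (_∘_)
open import Relation.Nullary using (¬_; Dec; yes; no; contradiction)
open import Relation.Unary using (Decidable)
open import Relation.Binary.PropositionalEquality
  using (_≡_; _≢_; refl; sym; trans; cong; cong₂; subst; subst₂; module ≡-Reasoning)

private variable
  m n l s : ℕ

-- Cardinalities and enumerations of finite sets.

surjective⇒≥ : (f : Fin m → Fin n) → (∀ y → ∃ λ x → f x ≡ y) → n ≤ m
surjective⇒≥ f surj = injective⇒≤ {f = proj₁ ∘ surj}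
  λ {y} {y′} e → trans (sym (proj₂ (surj y))) (trans (cong f e) (proj₂ (surj y′)))

injective₂⇒≤ : (h : Fin m → Fin n → Fin l) →
  (∀ i j i′ j′ → h i j ≡ h i′ j′ → i ≡ i′ × j ≡ j′) → m * n ≤ l
injective₂⇒≤ {m} {n} h inj = injective⇒≤ {f = uncurry h ∘ remQuot {m} n} λ {z} {z′} e →
  let i≡ , j≡ = inj _ _ _ _ e in
  trans (sym (combine-remQuot {m} n z)) (trans (cong₂ combine i≡ j≡) (combine-remQuot {m} n z′))

third : (i j : Fin (3 + n)) → ∃ λ k → k ≢ i × k ≢ j
third (suc i)       (suc j)       = zero , (λ ()) , (λ ())
third zero          zero          = suc zero , (λ ()) , (λ ())
third zero          (suc zero)    = suc (suc zero) , (λ ()) , (λ ())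
third zero          (suc (suc j)) = suc zero , (λ ()) , (λ ())
third (suc zero)    zero          = suc (suc zero) , (λ ()) , (λ ())
third (suc (suc i)) zero          = suc zero , (λ ()) , (λ ())

-- Expresses that `P` has exactly `s` elements. Proofs of `P x` are never compared, so `P` may be
-- any predicate.
record Enum (P : Fin n → Set) (s : ℕ) : Set where
  field
    at    : Fin s → Fin n
    inj   : ∀ {i j} → at i ≡ at j → i ≡ j
    sound : ∀ i → P (at i)
    index : ∀ {x} → P x → ∃ λ i → at i ≡ x
open Enum

enum-out : {P : Fin (suc n) → Set} → ¬ P zero → Enum (P ∘ suc) s → Enum P s
enum-out ¬p E .at        = suc ∘ at E
enum-out ¬p E .inj       = inj E ∘ suc-injective
enum-out ¬p E .sound     = sound E
enum-out ¬p E .index {zero}  p = contradiction p ¬p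
enum-out ¬p E .index {suc x} p = let i , e = index E p in i , cong suc e

enum-in : {P : Fin (suc n) → Set} → P zero → Enum (P ∘ suc) s → Enum P (suc s)
enum-in p E .at zero    = zero
enum-in p E .at (suc i) = suc (at E i)
enum-in p E .inj {zero}  {zero}  e = refl
enum-in p E .inj {suc i} {suc j} e = cong suc (inj E (suc-injective e))
enum-in p E .sound zero    = p
enum-in p E .sound (suc i) = sound E i
enum-in p E .index {zero}  _ = zero , refl
enum-in p E .index {suc x} q = let i , e = index E q in suc i , cong suc e

enum-map : {P Q : Fin n → Set} → (∀ {x} → P x → Q x) → (∀ {x} → Q x → P x) → Enum P s → Enum Q s
enum-map f g E .at      = at E
enum-map f g E .inj     = inj E
enum-map f g E .sound i = f (sound E i)
enum-map f g E .index q = index E (g q)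

enumerate : {P : Fin n → Set} → Decidable P → ∃ λ s → Enum P s
enumerate {zero} P? = 0 , record { at = λ () ; inj = λ { {()} } ; sound = λ () ; index = λ { {()} } }
enumerate {suc n} P? with P? zero | enumerate (P? ∘ suc)
... | yes p | s , E = suc s , enum-in p E
... | no ¬p | s , E = s , enum-out ¬p E

enumerateSubset : (A : Subset n) → Enum (_∈ A) (# A)
enumerateSubset []            = record { at = λ () ; inj = λ { {()} } ; sound = λ () ; index = λ { {()} } }
enumerateSubset (inside ∷ A)  = enum-in here (enum-map there drop-there (enumerateSubset A))
enumerateSubset (outside ∷ A) = enum-out (λ ()) (enum-map there drop-there (enumerateSubset A))

-- Projective planes

-- Incidence is a relation between two index sets, so that points and lines can be exchanged by
-- `dual`.
record Plane (m l : ℕ) : Set₁ where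
  field
    _I_  : Fin m → Fin l → Set
    join : ∀ {p q} → p ≢ q → ∃ λ ℓ → p I ℓ × q I ℓ
    meet : ∀ {ℓ k} → ℓ ≢ k → ∃ λ p → p I ℓ × p I k
    uniq : ∀ {p q ℓ k} → p ≢ q → p I ℓ → q I ℓ → p I k → q I k → ℓ ≡ k

  uniq-point : ∀ {p q ℓ k} → ℓ ≢ k → p I ℓ → q I ℓ → p I k → q I k → p ≡ q
  uniq-point {p} {q} ℓ≢k pℓ qℓ pk qk with p ≟ q
  ... | yes e = e
  ... | no ne = contradiction (uniq ne pℓ qℓ pk qk) ℓ≢k

  separated : ∀ {p q ℓ} → p I ℓ → ¬ q I ℓ → p ≢ q
  separated pℓ ¬qℓ refl = ¬qℓ pℓ

dual : Plane m l → Plane l m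
dual Π = record
  { _I_ = λ ℓ p → p I ℓ ; join = meet ; meet = join
  ; uniq = λ ne pℓ pk qℓ qk → uniq-point ne pℓ qℓ pk qk }
  where open Plane Π

module _ (Π : Plane m l) where
  open Plane Π

  -- Send a point `x` of `ℓ` to the line `px`. Two distinct points with the same image would put `p`
  -- on `ℓ`, and each line through `p` meets `ℓ`.
  perspective : ∀ {p ℓ} → ¬ p I ℓ → Enum (_I ℓ) s → Enum (p I_) s
  perspective {p = p} {ℓ} p∉ℓ E = record
    { at    = proj₁ ∘ J
    ; inj   = λ {i} {j} → inj-J {i} {j}
    ; sound = proj₂ ∘ proj₂ ∘ J
    ; index = index-J
    }
    where
    J : ∀ i → ∃ λ k → at E i I k × p I k
    J i = join (separated (sound E i) p∉ℓ)

    inj-J : ∀ {i j} → proj₁ (J i) ≡ proj₁ (J j) → i ≡ j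
    inj-J {i} {j} e = inj E (uniq-point (λ ℓ≡ → p∉ℓ (subst (p I_) (sym ℓ≡) (proj₂ (proj₂ (J i)))))
      (sound E i) (sound E j) (proj₁ (proj₂ (J i)))
      (subst (at E j I_) (sym e) (proj₁ (proj₂ (J j)))))

    index-J : ∀ {k} → p I k → ∃ λ i → proj₁ (J i) ≡ k
    index-J {k} pk with meet {ℓ} {k} (λ { refl → p∉ℓ pk })
    ... | x , xℓ , xk with index E xℓ
    ... | i , refl = i , uniq (separated xℓ p∉ℓ) (proj₁ (proj₂ (J i))) (proj₂ (proj₂ (J i))) xk pk

module _ (Π : Plane m l) where
  open Plane Π

  -- Every point other than `p` lies on exactly one line through `p`, and each of these `d` lines
  -- has `r` points besides `p`.
  count-points : ∀ {p d r} → Enum (p I_) d → (∀ ℓ → Enum (_I ℓ) (suc r)) → m ≡ suc (d * r)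
  count-points {p} {d} {r} E F =
    ℕₚ.≤-antisym (surjective⇒≥ h surj-h) (injective⇒≤ {f = h} (inj-h _ _))
    where
    i₀ : ∀ e → ∃ λ i → at (F (at E e)) i ≡ p
    i₀ e = index (F (at E e)) (sound E e)

    g : Fin d → Fin r → Fin m
    -- `punchIn` skips the position of `p` on the line.
    g e j = at (F (at E e)) (punchIn (proj₁ (i₀ e)) j)

    g-on : ∀ e j → g e j I at E e
    g-on e j = sound (F (at E e)) _

    g≢p : ∀ e j → g e j ≢ p
    g≢p e j eq = punchInᵢ≢i _ j (inj (F (at E e)) (trans eq (sym (proj₂ (i₀ e)))))

    inj-g : ∀ e j e′ j′ → g e j ≡ g e′ j′ → (e , j) ≡ (e′ , j′)
    inj-g e j e′ j′ eq with inj E (uniq (g≢p e j) (g-on e j) (sound E e)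
                              (subst (_I at E e′) (sym eq) (g-on e′ j′)) (sound E e′))
    ... | refl = cong (e ,_) (punchIn-injective (proj₁ (i₀ e)) _ _ (inj (F (at E e)) eq))

    h : Fin (suc (d * r)) → Fin m
    h zero    = p
    h (suc z) = uncurry g (remQuot r z)

    inj-h : ∀ z z′ → h z ≡ h z′ → z ≡ z′
    inj-h zero    zero     e = refl
    inj-h zero    (suc z′) e = contradiction (sym e) (g≢p _ _)
    inj-h (suc z) zero     e = contradiction e (g≢p _ _)
    inj-h (suc z) (suc z′) e = cong suc (trans (sym (combine-remQuot {d} r z))
      (trans (cong (uncurry combine) (inj-g _ _ _ _ e)) (combine-remQuot {d} r z′)))

    surj-h : ∀ q → ∃ λ z → h z ≡ q
    surj-h q with p ≟ q
    ... | yes e = zero , e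
    ... | no p≢q with join p≢q
    ... | k , pk , qk with index E pk
    ... | e , refl with index (F (at E e)) qk
    ... | i , ei = suc (combine e j) ,
      trans (cong (uncurry g) (remQuot-combine e j))
        (trans (cong (at (F (at E e))) (punchIn-punchOut i₀≢i)) ei)
      where
      i₀≢i : proj₁ (i₀ e) ≢ i
      i₀≢i refl = p≢q (trans (sym (proj₂ (i₀ e))) ei)
      j = punchOut i₀≢i

  -- For `p` on `ℓ`, `perspective` is used three times: from `ℓ` to the pencil at `a`, back to a
  -- line `h` missing both `a` and `p`, and on to the pencil at `p`. The bound `2 ≤ r` provides the
  -- third point of `ℓ` from which `h` is built.
  point-degree : ∀ {r ℓ} → 2 ≤ r → (∀ p k → Dec (p I k)) →
    (∃₂ λ a b → a ≢ b × ¬ a I ℓ × ¬ b I ℓ) →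
    Enum (_I ℓ) (suc r) → ∀ p → Enum (p I_) (suc r)
  point-degree {ℓ = ℓ} (s≤s (s≤s _)) I? (a , b , a≢b , a∉ℓ , b∉ℓ) E p with I? p ℓ
  ... | no p∉ℓ = perspective Π p∉ℓ E
  ... | yes pℓ with join a≢b
  ... | k , ak , bk with meet {ℓ} {k} (λ { refl → a∉ℓ ak })
  ... | y , yℓ , yk with index E pℓ | index E yℓ
  ... | i , refl | j , refl with third i j
  -- The line through b and a third point z of ℓ, off the line ab, misses both p and a.
  ... | c , c≢i , c≢j with join (separated (sound E c) b∉ℓ)
  ... | h , zh , bh = perspective Π p∉h (perspective (dual Π) a∉h (perspective Π a∉ℓ E))
    where
    z = at E c
    z∉k : ¬ z I k
    z∉k zk = c≢j (inj E (uniq-point (λ { refl → a∉ℓ ak }) (sound E c) yℓ zk yk))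
    p∉h : ¬ at E i I h
    p∉h ph = b∉ℓ (subst (b I_) (uniq (c≢i ∘ inj E) zh ph (sound E c) pℓ) bh)
    a∉h : ¬ a I h
    a∉h ah = z∉k (subst (z I_) (uniq a≢b ah bh ak bk) zh)

1+[1+r]r≡r²+r+1 : ∀ r → suc (suc r * r) ≡ r * r + r + 1
1+[1+r]r≡r²+r+1 = solve-∀

-- Degrees, line sizes and cardinality in a plane of order `r`.

module _ {r : ℕ} (2≤r : 2 ≤ r) (PP : ProjectivePlane r) where
  open ProjectivePlane PP renaming (m to points; l to lines)

  plane : Plane points lines
  plane = record
    { _I_  = λ p i → p ∈ L i
    ; join = λ p≢q → let i , on , _ = two-points _ _ p≢q in i , on
    ; meet = two-lines _ _
    ; uniq = λ p≢q pℓ qℓ pk qk → let _ , _ , u = two-points _ _ p≢q in trans (u _ pℓ qℓ) (sym (u _ pk qk))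
    }
  open Plane plane

  -- No three of the four points are collinear, so at least two of them are off any line.
  two-off : ∀ ℓ → ∃₂ λ a b → a ≢ b × ¬ a I ℓ × ¬ b I ℓ
  two-off ℓ with four-points
  ... | p₁ , p₂ , p₃ , p₄ , (d₁₂ , d₁₃ , d₁₄ , d₂₃ , d₂₄ , d₃₄) , c₁₂₃ , c₁₂₄ , c₁₃₄ , c₂₃₄
    with p₁ ∈? L ℓ | p₂ ∈? L ℓ | p₃ ∈? L ℓ | p₄ ∈? L ℓ
  ... | no n₁ | no n₂ | _     | _     = p₁ , p₂ , d₁₂ , n₁ , n₂
  ... | no n₁ | yes _ | no n₃ | _     = p₁ , p₃ , d₁₃ , n₁ , n₃
  ... | no n₁ | yes _ | yes _ | no n₄ = p₁ , p₄ , d₁₄ , n₁ , n₄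
  ... | no _  | yes b | yes c | yes d = contradiction (b , c , d) (c₂₃₄ ℓ)
  ... | yes _ | no n₂ | no n₃ | _     = p₂ , p₃ , d₂₃ , n₂ , n₃
  ... | yes _ | no n₂ | yes _ | no n₄ = p₂ , p₄ , d₂₄ , n₂ , n₄
  ... | yes a | no _  | yes c | yes d = contradiction (a , c , d) (c₁₃₄ ℓ)
  ... | yes _ | yes _ | no n₃ | no n₄ = p₃ , p₄ , d₃₄ , n₃ , n₄
  ... | yes a | yes b | yes c | _     = contradiction (a , b , c) (c₁₂₃ ℓ)
  ... | yes a | yes b | no _  | yes d = contradiction (a , b , d) (c₁₂₄ ℓ)

  -- The size of a single line is given. It fixes the degree of every point, which by duality fixes
  -- the size of every line.
  lines-through : ∀ p → Enum (p I_) (suc r)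
  lines-through = let ℓ , size = line-size in
    point-degree plane 2≤r (λ p i → p ∈? L i) (two-off ℓ)
      (subst (Enum (_∈ L ℓ)) size (enumerateSubset (L ℓ)))

  points-on : ∀ ℓ → Enum (_I ℓ) (suc r)
  points-on ℓ = let a , _ , _ , a∉ℓ , _ = two-off ℓ in
    perspective (dual plane) a∉ℓ (lines-through a)

  -- The sides of the triangle `p₁p₂p₃` have no common point: the first two meet only in `p₁`, which
  -- is off the third.
  line-avoiding : ∀ p → ∃ λ ℓ → ¬ p I ℓ
  line-avoiding p with four-points
  ... | p₁ , p₂ , p₃ , _ , (d₁₂ , d₁₃ , _ , d₂₃ , _) , c₁₂₃ , _
    with join d₁₂ | join d₁₃ | join d₂₃
  ... | j , 1j , 2j | k , 1k , 3k | h , 2h , 3h with p ∈? L j | p ∈? L k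
  ... | no p∉j | _      = j , p∉j
  ... | yes _  | no p∉k = k , p∉k
  ... | yes pj | yes pk = h , λ ph →
    c₁₂₃ h (subst (_I h) (uniq-point (λ { refl → c₁₂₃ j (1j , 2j , 3k) }) pj 1j pk 1k) ph , 2h , 3h)

  points≡ : points ≡ r * r + r + 1
  points≡ = trans (count-points plane (lines-through (proj₁ four-points)) points-on) (1+[1+r]r≡r²+r+1 r)

  lines≡ : lines ≡ r * r + r + 1
  lines≡ = trans (count-points (dual plane) (points-on (proj₁ line-size)) lines-through) (1+[1+r]r≡r²+r+1 r)

-- The lower bound

[m%n+o]%n≡[m+o]%n : ∀ m o n .{{_ : NonZero n}} → (m % n + o) % n ≡ (m + o) % n
[m%n+o]%n≡[m+o]%n m o n = trans (%-distribˡ-+ (m % n) o n)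
  (trans (cong (λ z → (z + o % n) % n) (m%n%n≡m%n m n)) (sym (%-distribˡ-+ m o n)))

-- reflect x i = x − i mod t, a Latin rectangle each of whose rows is an involution.
module _ {n t : ℕ} .{{_ : NonZero t}} where

  reflect : Fin n → Fin t → Fin t
  reflect x i = fromℕ< (m%n<n (toℕ x + (t ∸ toℕ i)) t)

  toℕ-reflect : ∀ x i → toℕ (reflect x i) ≡ (toℕ x + (t ∸ toℕ i)) % t
  toℕ-reflect x i = toℕ-fromℕ< _

  toℕ[i]≤t : (i : Fin t) → toℕ i ≤ t
  toℕ[i]≤t i = ℕₚ.<⇒≤ (toℕ<n i)

  module _ (n≤t : n ≤ t) where
    open ≡-Reasoning

    -- The sum is symmetric in `i` and `reflect x i`, whence the involution; `n ≤ t` lets its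
    -- residue determine `x`, whence injectivity in `x`.
    reflect-sum : ∀ x i → (toℕ (reflect x i) + toℕ i) % t ≡ toℕ x
    reflect-sum x i = begin
      (toℕ (reflect x i) + toℕ i) % t                   ≡⟨ cong (λ z → (z + toℕ i) % t) (toℕ-reflect x i) ⟩
      ((toℕ x + (t ∸ toℕ i)) % t + toℕ i) % t           ≡⟨ [m%n+o]%n≡[m+o]%n _ (toℕ i) t ⟩
      (toℕ x + (t ∸ toℕ i) + toℕ i) % t                 ≡⟨ cong (_% t) (ℕₚ.+-assoc (toℕ x) _ _) ⟩
      (toℕ x + (t ∸ toℕ i + toℕ i)) % t                 ≡⟨ cong (λ z → (toℕ x + z) % t) (ℕₚ.m∸n+n≡m (toℕ[i]≤t i)) ⟩
      (toℕ x + t) % t                                   ≡⟨ [m+n]%n≡m%n (toℕ x) t ⟩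
      toℕ x % t                                         ≡⟨ m<n⇒m%n≡m (ℕₚ.<-≤-trans (toℕ<n x) n≤t) ⟩
      toℕ x                                             ∎

    reflect-injectiveˡ : ∀ {x x′ i} → reflect x i ≡ reflect x′ i → x ≡ x′
    reflect-injectiveˡ {x} {x′} {i} e = toℕ-injective (trans (sym (reflect-sum x i))
      (trans (cong (λ j → (toℕ j + toℕ i) % t) e) (reflect-sum x′ i)))

    reflect-involutive : ∀ x i → reflect x (reflect x i) ≡ i
    reflect-involutive x i = toℕ-injective (begin
      toℕ (reflect x j)                      ≡⟨ toℕ-reflect x j ⟩
      (toℕ x + (t ∸ toℕ j)) % t              ≡⟨ cong (λ z → (z + (t ∸ toℕ j)) % t) (sym (reflect-sum x i)) ⟩
      ((toℕ j + toℕ i) % t + (t ∸ toℕ j)) % t ≡⟨ [m%n+o]%n≡[m+o]%n _ (t ∸ toℕ j) t ⟩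
      (toℕ j + toℕ i + (t ∸ toℕ j)) % t      ≡⟨ cong (λ z → (z + (t ∸ toℕ j)) % t) (ℕₚ.+-comm (toℕ j) (toℕ i)) ⟩
      (toℕ i + toℕ j + (t ∸ toℕ j)) % t      ≡⟨ cong (_% t) (ℕₚ.+-assoc (toℕ i) (toℕ j) _) ⟩
      (toℕ i + (toℕ j + (t ∸ toℕ j))) % t    ≡⟨ cong (λ z → (toℕ i + z) % t) (ℕₚ.m+[n∸m]≡n (toℕ[i]≤t j)) ⟩
      (toℕ i + t) % t                        ≡⟨ [m+n]%n≡m%n (toℕ i) t ⟩
      toℕ i % t                              ≡⟨ m<n⇒m%n≡m (toℕ<n i) ⟩
      toℕ i                                  ∎)
      where j = reflect x i

    reflect-injectiveʳ : ∀ {x i i′} → reflect x i ≡ reflect x i′ → i ≡ i′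
    reflect-injectiveʳ {x} {i} {i′} e =
      trans (sym (reflect-involutive x i)) (trans (cong (reflect x) e) (reflect-involutive x i′))

-- Any two distinct cells of a row are adjacent, so it is enough for completeness that any two
-- colours share a row.
HasCompleteColouring-K□K : ∀ {n q k} (col : Fin n → Fin q → Fin k) →
  (∀ {x y y′} → col x y ≡ col x y′ → y ≡ y′) →
  (∀ {x x′ y} → col x y ≡ col x′ y → x ≡ x′) →
  (∀ c c′ → ∃ λ x → ∃₂ λ y y′ → col x y ≡ c × col x y′ ≡ c′) →
  HasCompleteColouring (K n □ K q) k
HasCompleteColouring-K□K {n} {q} {k} col row-inj column-inj meets = f , proper , complete
  where
  f : Fin (n * q) → Fin k
  f = uncurry col ∘ remQuot {n} q

  f-combine : ∀ x y → f (combine x y) ≡ col x y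
  f-combine x y = cong (uncurry col) (remQuot-combine x y)

  col-proper : ∀ {x x′ y y′} → (x ≡ x′ × y ≢ y′) ⊎ (x ≢ x′ × y ≡ y′) → col x y ≢ col x′ y′
  col-proper (inj₁ (refl , y≢y′)) = y≢y′ ∘ row-inj
  col-proper (inj₂ (x≢x′ , refl)) = x≢x′ ∘ column-inj

  proper : Proper (K n □ K q) f
  proper u v = col-proper

  complete : Complete (K n □ K q) f
  complete c c′ c≢c′ with meets c c′
  ... | x , y , y′ , refl , refl = combine x y , combine x y′ , adj , f-combine x y , f-combine x y′
    where
    adj : Adj (K n □ K q) (combine x y) (combine x y′)
    adj = inj₁
      ( trans (cong proj₁ (remQuot-combine x y)) (sym (cong proj₁ (remQuot-combine x y′)))
      , λ e → c≢c′ (cong (col x) (trans (sym (cong proj₂ (remQuot-combine x y)))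
                                   (trans e (cong proj₂ (remQuot-combine x y′))))) )

-- The colouring of the grid by pairs of a line and an index.

module _ {n l : ℕ} (Π : Plane n l) where
  open Plane Π

  module _ {s t d : ℕ} .{{_ : NonZero t}}
    (through : ∀ p → Enum (p I_) s) (point-on : ∀ ℓ → ∃ (_I ℓ)) (avoiding : ∀ p → ∃ λ ℓ → ¬ p I ℓ)
    (n≤t : n ≤ t) (nd≤t : n * d ≤ t) where

    plane-colour : Fin n → Fin (s * t) ⊎ Fin d → Fin (l * t)
    plane-colour x (inj₁ z) = let e , i = remQuot t z in combine (at (through x) e) (reflect x i)
    -- The `n * d` leftover cells get pairwise distinct indices `combine x w`, which fit by `nd≤t`.
    -- The line misses `x`, so no block colour of row `x` recurs here.
    plane-colour x (inj₂ w) = combine (proj₁ (avoiding x)) (inject≤ (combine x w) nd≤t)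

    plane-colour-row : ∀ {x} y y′ → plane-colour x y ≡ plane-colour x y′ → y ≡ y′
    plane-colour-row {x} (inj₁ z) (inj₁ z′) eq with combine-injective {l} _ _ _ _ eq
    ... | e≡ , i≡ = cong inj₁ (trans (sym (combine-remQuot {s} t z)) (trans
      (cong₂ combine (inj (through x) e≡) (reflect-injectiveʳ n≤t i≡)) (combine-remQuot {s} t z′)))
    plane-colour-row {x} (inj₁ z) (inj₂ w) eq =
      contradiction (subst (x I_) (proj₁ (combine-injective {l} _ _ _ _ eq)) (sound (through x) _)) (proj₂ (avoiding x))
    plane-colour-row {x} (inj₂ w) (inj₁ z) eq =
      contradiction (subst (x I_) (sym (proj₁ (combine-injective {l} _ _ _ _ eq))) (sound (through x) _)) (proj₂ (avoiding x))
    plane-colour-row {x} (inj₂ w) (inj₂ w′) eq = cong inj₂ (proj₂ (combine-injective x w x w′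
      (inject≤-injective _ _ _ _ (proj₂ (combine-injective {l} _ _ _ _ eq)))))

    -- Within a column the index alone determines the row, whatever the lines are.
    plane-colour-column : ∀ {x x′} y → plane-colour x y ≡ plane-colour x′ y → x ≡ x′
    plane-colour-column (inj₁ z) eq = reflect-injectiveˡ n≤t {i = proj₂ (remQuot {s} t z)} (proj₂ (combine-injective {l} _ _ _ _ eq))
    plane-colour-column {x} {x′} (inj₂ w) eq = proj₁ (combine-injective x w x′ w
      (inject≤-injective _ _ _ _ (proj₂ (combine-injective {l} _ _ _ _ eq))))

    -- By involutivity, index `j` stands at position `reflect x j` of the block of `ℓ` in row `x`.
    plane-colour-onto : ∀ {x ℓ} → x I ℓ → ∀ j → ∃ λ z → plane-colour x (inj₁ z) ≡ combine ℓ j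
    plane-colour-onto {x} xℓ j with index (through x) xℓ
    ... | e , refl = combine e (reflect x j) ,
      trans (cong (λ (e , i) → combine (at (through x) e) (reflect x i)) (remQuot-combine e (reflect x j)))
        (cong (combine (at (through x) e)) (reflect-involutive n≤t x j))

    -- Two distinct colours may have the same line, where any point of it serves.
    common-point : ∀ ℓ k → ∃ λ x → x I ℓ × x I k
    common-point ℓ k with ℓ ≟ k
    ... | yes refl = let x , xℓ = point-on ℓ in x , xℓ , xℓ
    ... | no  ℓ≢k  = meet ℓ≢k

    plane-colouring : HasCompleteColouring (K n □ K (s * t + d)) (l * t)
    plane-colouring = HasCompleteColouring-K□K (λ x → plane-colour x ∘ splitAt (s * t))
      (λ {x} {y} {y′} eq → splitAt-injective y y′ (plane-colour-row _ _ eq))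
      (λ {_} {_} {y} → plane-colour-column (splitAt (s * t) y))
      meets
      where
      splitAt-injective : ∀ y y′ → splitAt (s * t) y ≡ splitAt (s * t) {d} y′ → y ≡ y′
      splitAt-injective y y′ e =
        trans (sym (join-splitAt (s * t) d y)) (trans (cong (joinFin (s * t) d) e) (join-splitAt (s * t) d y′))

      meets : ∀ c c′ → ∃ λ x → ∃₂ λ y y′ →
        plane-colour x (splitAt (s * t) y) ≡ c × plane-colour x (splitAt (s * t) y′) ≡ c′
      meets c c′ with remQuot {l} t c in ec | remQuot {l} t c′ in ec′
      ... | ℓ , j | k , j′ with common-point ℓ k
      ... | x , xℓ , xk with plane-colour-onto xℓ j | plane-colour-onto xk j′
      ... | z , ez | z′ , ez′ = x , z ↑ˡ d , z′ ↑ˡ d , lift c ec ez , lift c′ ec′ ez′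
        where
        lift : ∀ {x z ℓ j} c → remQuot {l} t c ≡ (ℓ , j) → plane-colour x (inj₁ z) ≡ combine ℓ j →
          plane-colour x (splitAt (s * t) (z ↑ˡ d)) ≡ c
        lift {x} {z} c ec ez = trans (cong (plane-colour x) (splitAt-↑ˡ (s * t) z d))
          (trans ez (trans (cong (uncurry combine) (sym ec)) (combine-remQuot {l} t c)))

-- The upper bound

module _ {n q k : ℕ} (f : Fin (n * q) → Fin k) (complete : Complete (K n □ K q) f) where

  -- By completeness each other colour occurs in the row (`q` cells) or the column (`n` cells) of
  -- one of the `s` vertices coloured `c`. The successor counts `c` itself.
  rare-colour⇒≤ : ∀ {c} → Enum (λ v → f v ≡ c) s → k ≤ suc (s * (q + n))
  rare-colour⇒≤ {s} {c} E = surjective⇒≥ seen seen-all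
    where
    seen-from : Fin n × Fin q → Fin q ⊎ Fin n → Fin k
    seen-from (x , y) (inj₁ y′) = f (combine x y′)
    seen-from (x , y) (inj₂ x′) = f (combine x′ y)

    neighbour-seen : ∀ a b → (proj₁ a ≡ proj₁ b × proj₂ a ≢ proj₂ b) ⊎ (proj₁ a ≢ proj₁ b × proj₂ a ≡ proj₂ b) →
      ∃ λ w → seen-from a w ≡ f (uncurry combine b)
    neighbour-seen (x , y) (.x , y′) (inj₁ (refl , _)) = inj₁ y′ , refl
    neighbour-seen (x , y) (x′ , .y) (inj₂ (_ , refl)) = inj₂ x′ , refl

    seen-at : Fin s → Fin (q + n) → Fin k
    seen-at i w = seen-from (remQuot {n} q (at E i)) (splitAt q w)

    seen : Fin (suc (s * (q + n))) → Fin k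
    seen zero    = c
    seen (suc z) = uncurry seen-at (remQuot (q + n) z)

    seen-all : ∀ c′ → ∃ λ z → seen z ≡ c′
    seen-all c′ with c ≟ c′
    ... | yes refl = zero , refl
    ... | no c≢c′ with complete c c′ c≢c′
    ... | u , v , adj , fu≡c , refl with index E fu≡c
    ... | i , refl with neighbour-seen (remQuot {n} q u) (remQuot {n} q v) adj
    ... | w , seen-v = suc (combine i (joinFin q n w)) ,
      trans (cong (uncurry seen-at) (remQuot-combine i (joinFin q n w)))
        (trans (cong (seen-from (remQuot {n} q u)) (splitAt-join q n w))
          (trans seen-v (cong f (combine-remQuot {n} q v))))

  -- Colour classes are disjoint, so `s` vertices chosen from each are distinct.
  frequent-colours⇒≤ : ∀ {s} → (∀ c → ∃ λ m → s ≤ m × Enum (λ v → f v ≡ c) m) → k * s ≤ n * q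
  frequent-colours⇒≤ {s} E = injective₂⇒≤ h h-inj
    where
    h : Fin k → Fin s → Fin (n * q)
    h c i = let _ , s≤m , Ec = E c in at Ec (inject≤ i s≤m)

    f-h : ∀ c i → f (h c i) ≡ c
    f-h c i = sound (proj₂ (proj₂ (E c))) _

    h-inj : ∀ c i c′ i′ → h c i ≡ h c′ i′ → c ≡ c′ × i ≡ i′
    h-inj c i c′ i′ e with trans (sym (f-h c i)) (trans (cong f e) (f-h c′ i′))
    ... | refl = refl , inject≤-injective _ _ i i′ (inj (proj₂ (proj₂ (E c))) e)

  colour-class : ∀ c → ∃ λ m → Enum (λ v → f v ≡ c) m
  colour-class c = enumerate (λ v → f v ≟ c)

  colours-≤ : ∀ r → k ≤ suc (r * (q + n)) ⊎ k * suc r ≤ n * q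
  colours-≤ r with all? (λ c → suc r ℕ.≤? proj₁ (colour-class c))
  ... | yes frequent = inj₂ (frequent-colours⇒≤ λ c → let m , E = colour-class c in m , frequent c , E)
  ... | no ¬frequent with ¬∀⟶∃¬ _ _ (λ c → suc r ℕ.≤? proj₁ (colour-class c)) ¬frequent
  ... | c , rare = inj₁ (ℕₚ.≤-trans (rare-colour⇒≤ (proj₂ (colour-class c)))
    (s≤s (ℕₚ.*-monoˡ-≤ (q + n) (ℕₚ.≤-pred (ℕₚ.≰⇒> rare)))))

-- The limit

-- Dividing the bounds by `q * s` gives `0 ≤ n/s - a q/q ≤ n/q`. If `ε` has denominator `v`, then
-- `ε ≥ 1/v`, which exceeds `n/q` once `q > n * v`.
converges : ∀ {n s} .{{_ : NonZero s}} (a : ℕ → ℕ) (N : ℕ) →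
  (∀ q → N ≤ q → a q * s ≤ n * q × n * q ≤ a q * s + n * s) →
  Converges (λ q → (+ a q) / q) ((+ n) / s)
-- The successor makes `n * v < q` strict and also excludes `q = 0`.
converges {n} {s@(suc s-1)} a N bounds ε@(ℚ.mkℚ (+ suc u) v-1 _) _ = suc (n * v) ℕ.⊔ N , close
  where
  v = suc v-1

  close : ∀ q .{{_ : NonZero q}} → suc (n * v) ℕ.⊔ N ≤ q → ℚ.∣ (+ a q) / q ℚ.- (+ n) / s ∣ ℚ.< ε
  close zero le = contradiction (ℕₚ.≤-trans (ℕₚ.m≤m⊔n (suc (n * v)) N) le) λ ()
  close q@(suc q-1) le = ℚₚ.toℚᵘ-cancel-< (ℚᵘₚ.<-respˡ-≃ (ℚᵘₚ.≃-sym homo) (*<* (subst₂ ℤ._<_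
    (trans (ℤₚ.pos-* D v) (cong (ℤ._* + v) (cong +_ (sym numerator)))) (ℤₚ.pos-* (suc u) (q * s)) (+<+ D*v<))))
    where
    A B : ℚᵘ
    A = mkℚᵘ (+ a q) q-1
    B = mkℚᵘ (+ n) s-1

    D : ℕ
    D = n * q ∸ a q * s

    -- Unnormalised rationals keep the denominator `q * s` explicit, which reduces the claim to an
    -- inequality of naturals.
    homo : ℚ.toℚᵘ ℚ.∣ (+ a q) / q ℚ.- (+ n) / s ∣ ≃ᵘ ∣ A -ᵘ B ∣ᵘ
    homo = ℚᵘₚ.≃-trans (ℚₚ.toℚᵘ-homo-∣-∣ _) (ℚᵘₚ.∣-∣-cong (ℚᵘₚ.≃-trans (ℚₚ.toℚᵘ-homo-+ ((+ a q) / q) (ℚ.- ((+ n) / s)))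
      (ℚᵘₚ.+-cong (ℚₚ.toℚᵘ-fromℚᵘ A)
        (ℚᵘₚ.≃-trans (ℚₚ.toℚᵘ-homo‿- _) (ℚᵘₚ.-‿cong (ℚₚ.toℚᵘ-fromℚᵘ B))))))

    numerator : ℤ.∣ + a q ℤ.* + s ℤ.+ (ℤ.- + n) ℤ.* + q ∣ ≡ D
    numerator = begin
      ℤ.∣ + a q ℤ.* + s ℤ.+ (ℤ.- + n) ℤ.* + q ∣ ≡⟨ cong₂ (λ x y → ℤ.∣ x ℤ.+ y ∣) (sym (ℤₚ.pos-* (a q) s))
                                                    (trans (sym (ℤₚ.neg-distribˡ-* (+ n) (+ q))) (cong ℤ.-_ (sym (ℤₚ.pos-* n q)))) ⟩
      ℤ.∣ + (a q * s) ℤ.- + (n * q) ∣           ≡⟨ cong ℤ.∣_∣ (ℤₚ.m-n≡m⊖n (a q * s) (n * q)) ⟩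
      ℤ.∣ (a q * s) ℤ.⊖ (n * q) ∣               ≡⟨ ℤₚ.∣⊖∣-≤ (proj₁ (bounds q (ℕₚ.m⊔n≤o⇒n≤o (suc (n * v)) N le))) ⟩
      D                                         ∎
      where open ≡-Reasoning

    D*v< : D * v < suc u * (q * s)
    D*v< = begin-strict
      D * v           ≤⟨ ℕₚ.*-monoˡ-≤ v (ℕₚ.m≤n+o⇒m∸n≤o _ (a q * s) (proj₂ (bounds q (ℕₚ.m⊔n≤o⇒n≤o (suc (n * v)) N le)))) ⟩
      n * s * v       ≡⟨ rearrange n s v ⟩
      n * v * s       <⟨ ℕₚ.*-monoˡ-< s (ℕₚ.m⊔n≤o⇒m≤o (suc (n * v)) N le) ⟩
      q * s           ≤⟨ ℕₚ.m≤n*m (q * s) (suc u) ⟩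
      suc u * (q * s) ∎
      where
      open ℕₚ.≤-Reasoning
      rearrange : ∀ n s v → n * s * v ≡ n * v * s
      rearrange = solve-∀
converges a N bounds (ℚ.mkℚ (+ 0) _ _) (ℚ.*<* (+<+ ()))
converges a N bounds (ℚ.mkℚ ℤ.-[1+ _ ] _ _) (ℚ.*<* ())

-- Bounds on the achromatic number for large `q`.

module _ {r : ℕ} (2≤r : 2 ≤ r) (PP : ProjectivePlane r) where
  open ℕₚ.≤-Reasoning

  private
    N = r * r + r + 1
    R = suc r

  achr-lower : ∀ t d .{{_ : NonZero t}} → N ≤ t → N * d ≤ t → HasCompleteColouring (K N □ K (R * t + d)) (N * t)
  achr-lower t d n≤t nd≤t = subst₂ Colouring (points≡ 2≤r PP) (lines≡ 2≤r PP)
      (λ n≤t nd≤t → plane-colouring (plane 2≤r PP) (lines-through 2≤r PP)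
        (λ ℓ → let E = points-on 2≤r PP ℓ in at E zero , sound E zero) (line-avoiding 2≤r PP) n≤t nd≤t)
      n≤t nd≤t
    where
    Colouring : ℕ → ℕ → Set
    -- The size conditions mention `n`, so they are transported together with it.
    Colouring n l = n ≤ t → n * d ≤ t → HasCompleteColouring (K n □ K (R * t + d)) (l * t)

  -- With `t` and `d` the quotient and remainder of `q` by `R`, the plane gives `N * t` colours, and
  -- the remainder costs at most `N * R`. The threshold forces `N * R ≤ t`, which yields both
  -- `N ≤ t` and `N * d ≤ t`.
  achr-≥ : ∀ {a} q → IsAchr (K N □ K q) a → N * R * R ≤ q → N * q ≤ a * R + N * R
  achr-≥ {a} q (_ , max) large = begin
    N * q                 ≡⟨ cong (N *_) q≡ ⟩
    N * (R * t + d)       ≤⟨ ℕₚ.*-monoʳ-≤ N (ℕₚ.+-monoʳ-≤ (R * t) d≤R) ⟩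
    N * (R * t + R)       ≡⟨ rearrange N R t ⟩
    N * t * R + N * R     ≤⟨ ℕₚ.+-monoˡ-≤ (N * R) (ℕₚ.*-monoˡ-≤ R (max _ colouring)) ⟩
    a * R + N * R         ∎
    where
    t = q ℕ./ R
    d = q % R
    rearrange : ∀ n s t → n * (s * t + s) ≡ n * t * s + n * s
    rearrange = solve-∀
    q≡ : q ≡ R * t + d
    q≡ = trans (m≡m%n+[m/n]*n q R) (trans (ℕₚ.+-comm d (t * R)) (cong (_+ d) (ℕₚ.*-comm t R)))
    d≤R : d ≤ R
    d≤R = ℕₚ.<⇒≤ (m%n<n q R)
    NR≤t : N * R ≤ t
    NR≤t = subst (_≤ t) (m*n/n≡m (N * R) R) (/-monoˡ-≤ R large)
    N≤t : N ≤ t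
    N≤t = ℕₚ.≤-trans (ℕₚ.m≤m*n N R) NR≤t
    instance
      t≢0 : NonZero t
      t≢0 = ℕ.>-nonZero (ℕₚ.<-≤-trans (ℕₚ.m≤n+m 1 (r * r + r)) N≤t)
    colouring : HasCompleteColouring (K N □ K q) (N * t)
    colouring = subst (λ q → HasCompleteColouring (K N □ K q) (N * t)) (sym q≡)
      (achr-lower t d N≤t (ℕₚ.≤-trans (ℕₚ.*-monoʳ-≤ N d≤R) NR≤t))

module _ (r : ℕ) where
  open ℕₚ.≤-Reasoning

  private
    N = r * r + r + 1

  -- If some colour is rare, the bound multiplied by `r + 1` has `q`-coefficient `r * r + r`, one
  -- less than `N`; the threshold lets the spare `q` absorb the constant term.
  achr-≤ : ∀ {a} q → HasCompleteColouring (K N □ K q) a → suc r * suc (r * N) ≤ q → a * suc r ≤ N * q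
  achr-≤ {a} q (f , _ , complete) large with colours-≤ f complete r
  ... | inj₂ le = le
  ... | inj₁ le = begin
    a * suc r                                      ≤⟨ ℕₚ.*-monoˡ-≤ (suc r) le ⟩
    suc (r * (q + N)) * suc r                      ≡⟨ rearrange r q N ⟩
    (r * r + r) * q + suc r * suc (r * N)          ≤⟨ ℕₚ.+-monoʳ-≤ ((r * r + r) * q) large ⟩
    (r * r + r) * q + q                            ≡⟨ rearrange′ r q ⟩
    N * q                                          ∎
    where
    rearrange : ∀ r q n → suc (r * (q + n)) * suc r ≡ (r * r + r) * q + suc r * suc (r * n)
    rearrange = solve-∀
    rearrange′ : ∀ r q → (r * r + r) * q + q ≡ (r * r + r + 1) * q
    rearrange′ = solve-∀

theorem4p1 : (r : ℕ) → 2 ≤ r → ProjectivePlane r →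
    (a : ℕ → ℕ) → (∀ q → IsAchr (K (r * r + r + 1) □ K q) (a q)) →
    Converges (λ q → (+ a q) / q) ((+ (r * r + r + 1)) / suc r)
theorem4p1 r 2≤r PP a achr = converges {r * r + r + 1} a (N₁ ℕ.⊔ N₂) λ q N≤q →
    achr-≤ r q (proj₁ (achr q)) (ℕₚ.m⊔n≤o⇒m≤o N₁ N₂ N≤q) ,
    achr-≥ 2≤r PP q (achr q) (ℕₚ.m⊔n≤o⇒n≤o N₁ N₂ N≤q)
  where
  -- The thresholds of the upper and the lower bound respectively.
  N₁ = suc r * suc (r * (r * r + r + 1))
  N₂ = (r * r + r + 1) * suc r * suc r
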